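{- Let $\mathcal{D}$ be the set of all partitions into distinct parts (including the empty partition), and let $\mathcal{A}$ be the set of all partitions $\pi$ (including the empty partition) satisfying $p_2(\pi)\leq t(\pi)$. Then for $i=1$ and $i=2$ we have, as formal power series in $q$, \[ \sum_{\pi\in\mathcal{D}} w_i(\pi)\, q^{|\pi|} = \sum_{\pi\in \mathcal{A}} \hat{w}_i(\pi)\, q^{|\pi|}, \] where \[ w_i(\pi) = \left[1- f_1\left(\frac{1- (-1)^{t(\pi)}}{2}\right) \right](-1)^{i\, \#(\pi)}, \qquad \hat{w}_i(\pi) = 2^{r_2(\pi)}\left(\frac{(-1)^{t(\pi)}+(-1)^{p_2(\pi)}}{2} \right)(-1)^{(i-1) (r_1(\pi)+t(\pi)+p_2(\pi))}. \]
   Context: A partition $\pi$ is written in frequency notation $(1^{f_1},2^{f_2},3^{f_3},\dots)$ with $f_k\in\mathbb{Z}_{\ge0}$, all but finitely many zero; $f_k$ is the number of times the part $k$ occurs. It is distinct if all $f_k\le 1$. The size is $|\pi|=\sum_k k f_k$ and the number of parts is $\#(\pi)=\sum_k f_k$. The statistic $t(\pi)$ is the length of the initial frequency chain: the largest $t\ge 0$ such that $f_1,f_2,\dots,f_t$ are all nonzero (so $t(\pi)=0$ if $f_1=0$). For $j\ge1$, $p_j(\pi)$ is the largest index $k$ with $f_k\ge j$, and $p_j(\pi)=0$ if no such $k$ exists. For $j\ge 1$, $r_j(\pi)$ is the number of distinct part sizes $k$ with $f_k\ge j$. Example: for $\pi=(1^4,2^2,3^4,5^1,6^1)$, $|\pi|=31$,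 $\#(\pi)=12$, $t(\pi)=3$, $p_1(\pi)=6$, $p_2(\pi)=p_3(\pi)=p_4(\pi)=3$, $p_5(\pi)=0$, $r_1(\pi)=5$, $r_2(\pi)=3$, $r_3(\pi)=r_4(\pi)=2$, $r_5(\pi)=0$. -}

module Defs where

open import Data.Bool using (Bool; true; false; if_then_else_; _∧_)
open import Data.Nat as ℕ using (ℕ; zero; suc; _≤ᵇ_; _≡ᵇ_; _⊔_)
open import Data.List using (List; []; _∷_; map; concatMap; upTo; filterᵇ; zipWith; foldr; length; applyUpTo)
open import Data.Nat.ListAction using (sum)
open import Data.Integer as ℤ using (ℤ; +_; -_; _*_; _+_; _-_)
open import Data.Integer.DivMod using (_/_)

-- A partition of size n is encoded by its frequency list (f_1, ..., f_n):
-- the j-th entry (1-based) is the multiplicity f_j of the part j.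
-- (Parts of a partition of n are ≤ n, so f_k = 0 for k > n.)
Freq : Set
Freq = List ℕ

indexed : (ℕ → ℕ → ℕ) → Freq → List ℕ
indexed g f = zipWith g (applyUpTo suc (length f)) f

size : Freq → ℕ
size f = sum (indexed (λ k x → k ℕ.* x) f)

numParts : Freq → ℕ
numParts f = sum f

tStat : Freq → ℕ
tStat [] = 0
tStat (zero ∷ _) = 0
tStat (suc _ ∷ xs) = suc (tStat xs)

pStat : ℕ → Freq → ℕ
pStat j f = foldr _⊔_ 0 (indexed (λ k x → if j ≤ᵇ x then k else 0) f)

rStat : ℕ → Freq → ℕ
rStat j f = length (filterᵇ (j ≤ᵇ_) f)

isDistinct : Freq → Bool
isDistinct f = foldr _∧_ true (map (_≤ᵇ 1) f)

inA : Freq → Bool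
inA f = pStat 2 f ≤ᵇ tStat f

allLists : ℕ → ℕ → List Freq
allLists zero b = [] ∷ []
allLists (suc n) b = concatMap (λ x → map (x ∷_) (allLists n b)) (upTo (suc b))

partitionsOf : ℕ → List Freq
partitionsOf n = filterᵇ (λ f → size f ≡ᵇ n) (allLists n n)

sumℤ : List ℤ → ℤ
sumℤ = foldr _+_ (+ 0)

sgn : ℕ → ℤ
sgn zero = + 1
sgn (suc k) = - sgn k

f1 : Freq → ℕ
f1 [] = 0
f1 (x ∷ _) = x

w : ℕ → Freq → ℤ
w i f = (+ 1 - (+ f1 f) * ((+ 1 - sgn (tStat f)) / + 2)) * sgn (i ℕ.* numParts f)

ŵ : ℕ → Freq → ℤ
ŵ i f = (+ (2 ℕ.^ rStat 2 f)) * ((sgn (tStat f) + sgn (pStat 2 f)) / + 2)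
        * sgn ((i ℕ.∸ 1) ℕ.* (rStat 1 f ℕ.+ tStat f ℕ.+ pStat 2 f))

lhsCoeff : ℕ → ℕ → ℤ
lhsCoeff i n = sumℤ (map (w i) (filterᵇ isDistinct (partitionsOf n)))

rhsCoeff : ℕ → ℕ → ℤ
rhsCoeff i n = sumℤ (map (ŵ i) (filterᵇ inA (partitionsOf n)))

{-# OPTIONS --safe #-}
-- Put z = (-1)^(i-1) and let L_k, W_k be the left and right sums over partitions with all parts > k, where chains
-- start at k + 1 instead of 1. Summing over the multiplicity of the part k + 1 gives
--   L_k = ∏_{j>k} (1 - z q^j) + z q^(k+1) L_{k+1},
--   W_k = ∏_{j>k} (1 + z q^j) - z q^(k+1) (1 + q^(k+1)) / (1 - q^(k+1)) W_{k+1}.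
-- The second recurrence unrolls to W_0 = F(z), where
--   F(x) = Σ_p (-x)^p q^(p(p+1)/2) (-q;q)_p / (q;q)_p (-x q^(p+1);q)_∞.
-- A telescoping sum shows F(x) - F(xq) + (1 - xq) x q² F(xq²) = 0, so S(x) = F(x) - x q F(xq) satisfies
-- S(x) = (1 - xq) S(xq), whence S(x) = (xq;q)_∞. Thus F(z q^k) obeys the recurrence of L_k, and L_0 = F(z).
-- (This is a confluent case of Heine's transformation.) To compare coefficients of q^n, everything happens modulo
-- q^(n+1), where q is nilpotent and all products and sums are finite.
module Submission where

open import Defs
open import Algebra.Bundles using (CommutativeRing)
import Algebra.Properties.Semiring.Exp as Exp
import Algebra.Solver.Ring
open import Algebra.Solver.Ring.AlmostCommutativeRing using (fromCommutativeRing; _-Raw-AlmostCommutative⟶_)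
open import Data.Bool using (Bool; true; false; if_then_else_)
open import Data.Integer as ℤ using (ℤ; +_; -[1+_])
open import Data.Integer.DivMod using (_/_)
import Data.Integer.Properties as ℤ
open import Data.Integer.Tactic.RingSolver using (solve-∀)
open import Data.List using (List; []; _∷_; _++_; map; concatMap; applyUpTo; upTo; filterᵇ; foldr; zipWith; length)
open import Data.Maybe using (Maybe; just; nothing)
open import Data.Nat as ℕ using (ℕ; zero; suc; _≤_; z≤n; s≤s; _≤ᵇ_; _≡ᵇ_; _⊔_)
open import Data.Nat.ListAction using (sum)
import Data.Nat.Properties as ℕ
open import Data.Product using (∃; _,_)
open import Data.Sum using (_⊎_; inj₁; inj₂)
open import Function using (_∘_)
open import Level using (0ℓ)
open import Relation.Binary.PropositionalEquality as ≡ using (_≡_; cong; cong₂; _≗_)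
open import Relation.Nullary using (yes; no)

-- Partitions with all parts above k and recurrences for their weights

sizeFrom : ℕ → Freq → ℕ
sizeFrom k []      = 0
sizeFrom k (x ∷ f) = suc k ℕ.* x ℕ.+ sizeFrom (suc k) f

-- φ is the weight on either side (extended by 0), δ its sign factor alone, restricted to distinct partitions.
record ChainRecurrence (ζ c : ℤ) (δ φ : Freq → ℤ) : Set where
  field
    δ-[] : δ [] ≡ + 1
    δ-0  : ∀ f → δ (0 ∷ f) ≡ δ f
    δ-1  : ∀ f → δ (1 ∷ f) ≡ ζ ℤ.* δ f
    δ-2  : ∀ x f → δ (suc (suc x) ∷ f) ≡ + 0
    φ-[] : φ [] ≡ + 1
    φ-0  : ∀ f → φ (0 ∷ f) ≡ δ f
    φ-1  : ∀ f → φ (1 ∷ f) ≡ ζ ℤ.* (δ f ℤ.- φ f)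
    φ-2  : ∀ x f → φ (suc (suc x) ∷ f) ≡ c ℤ.* φ f

-- Generating functions over a commutative ring with nilpotent q

module GeneratingFunctions
  (R : CommutativeRing 0ℓ 0ℓ)
  (ι : ℤ.+-*-rawRing -Raw-AlmostCommutative⟶ fromCommutativeRing R)
  (N : ℕ) (q : CommutativeRing.Carrier R)
  (q-nilpotent : CommutativeRing._≈_ R (Exp._^_ (CommutativeRing.semiring R) q (suc (suc N))) (CommutativeRing.0# R))
  where

  open CommutativeRing R
  open Exp semiring
  open _-Raw-AlmostCommutative⟶_ ι
  open import Algebra.Properties.Ring ring
  open import Relation.Binary.Reasoning.Setoid setoid

  private
    n = suc N

    coeff≟ : ∀ a b → Maybe (⟦ a ⟧ ≈ ⟦ b ⟧)
    coeff≟ a b with a ℤ.≟ b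
    ... | yes ≡.refl = just refl
    ... | no  _      = nothing

  open Algebra.Solver.Ring ℤ.+-*-rawRing (fromCommutativeRing R) ι coeff≟
    using (Polynomial; con; _:+_; _:*_; _:-_; :-_; _:^_; _:=_; solve)

  -- con (+ 1) denotes ⟦ + 1 ⟧, which is not definitionally 1#.
  :1 : ∀ {k} → Polynomial k
  :1 = con (+ 1) :^ 0

  -- Finite products in place of (-xq;q)_∞

  q^[1+p+n]≈0 : ∀ p → q ^ (p ℕ.+ suc n) ≈ 0#
  q^[1+p+n]≈0 p = begin
    q ^ (p ℕ.+ suc n)   ≈⟨ ^-homo-* q p (suc n) ⟩
    q ^ p * q ^ suc n   ≈⟨ *-congˡ q-nilpotent ⟩
    q ^ p * 0#          ≈⟨ zeroʳ _ ⟩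
    0#                  ∎

  ∏[1+xq^1…q^_] : ℕ → Carrier → Carrier
  ∏[1+xq^1…q^ zero  ] x = 1#
  ∏[1+xq^1…q^ suc m ] x = (1# + x * q) * ∏[1+xq^1…q^ m ] (x * q)

  ∏-cong : ∀ m {x y} → x ≈ y → ∏[1+xq^1…q^ m ] x ≈ ∏[1+xq^1…q^ m ] y
  ∏-cong zero    x≈y = refl
  ∏-cong (suc m) x≈y = *-cong (+-congˡ (*-congʳ x≈y)) (∏-cong m (*-congʳ x≈y))

  ∏-snoc : ∀ m x → ∏[1+xq^1…q^ suc m ] x ≈ ∏[1+xq^1…q^ m ] x * (1# + x * q ^ suc m)
  ∏-snoc zero    x = solve 2 (λ x q → (:1 :+ x :* q) :* :1 := :1 :* (:1 :+ x :* (q :* :1))) refl x q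
  ∏-snoc (suc m) x = begin
    (1# + x * q) * ∏[1+xq^1…q^ suc m ] (x * q)
      ≈⟨ *-congˡ (∏-snoc m (x * q)) ⟩
    (1# + x * q) * (∏[1+xq^1…q^ m ] (x * q) * (1# + x * q * q ^ suc m))
      ≈⟨ *-assoc _ _ _ ⟨
    ∏[1+xq^1…q^ suc m ] x * (1# + x * q * q ^ suc m)
      ≈⟨ *-congˡ (+-congˡ (*-assoc _ _ _)) ⟩
    ∏[1+xq^1…q^ suc m ] x * (1# + x * q ^ suc (suc m)) ∎

  ∏ : Carrier → Carrier
  ∏ = ∏[1+xq^1…q^ n ]

  -- Peeling the first factor leaves a product with one factor too few; the missing one, 1 + x
  -- q^(n+1), equals 1. So the finite product behaves like the infinite one.
  ∏-unfold : ∀ x → ∏ x ≈ (1# + x * q) * ∏ (x * q)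
  ∏-unfold x = begin
    ∏ x                           ≈⟨ *-identityʳ _ ⟨
    ∏ x * 1#                      ≈⟨ *-congˡ (+-identityʳ _) ⟨
    ∏ x * (1# + 0#)               ≈⟨ *-congˡ (+-congˡ (trans (*-congˡ q-nilpotent) (zeroʳ x))) ⟨
    ∏ x * (1# + x * q ^ suc n)    ≈⟨ ∏-snoc n x ⟨
    (1# + x * q) * ∏ (x * q)      ∎

  ∏-zero : ∀ m → ∏[1+xq^1…q^ m ] 0# ≈ 1#
  ∏-zero zero    = refl
  ∏-zero (suc m) = begin
    (1# + 0# * q) * ∏[1+xq^1…q^ m ] (0# * q)
      ≈⟨ *-cong (trans (+-congˡ (zeroˡ q)) (+-identityʳ 1#)) (trans (∏-cong m (zeroˡ q)) (∏-zero m)) ⟩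
    1# * 1#  ≈⟨ *-identityˡ 1# ⟩
    1#       ∎

  -- Truncated geometric series

  ∑∈ : {A : Set} → List A → (A → Carrier) → Carrier
  ∑∈ []       g = 0#
  ∑∈ (a ∷ as) g = g a + ∑∈ as g

  -- `τ y` collects the multiplicities 2 to n of one part. They count twice in `ρ y` because a
  -- repeated part contributes a factor 2 to 2^(r₂).
  τ ρ : Carrier → Carrier
  τ y = ∑∈ (applyUpTo (suc ∘ suc) N) (y ^_)
  ρ y = y + τ y + τ y

  -- The exponent function `h` is left general because recursion on `applyUpTo` composes it with
  -- `suc`.
  geometric : ∀ y m a (h : ℕ → ℕ) → (∀ j → h j ≡ a ℕ.+ j) →
              (1# - y) * ∑∈ (applyUpTo h m) (y ^_) + y ^ (a ℕ.+ m) ≈ y ^ a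
  geometric y zero    a h h≡ = begin
    (1# - y) * 0# + y ^ (a ℕ.+ 0)  ≈⟨ +-cong (zeroʳ _) (^-congʳ y (ℕ.+-identityʳ a)) ⟩
    0# + y ^ a                     ≈⟨ +-identityˡ _ ⟩
    y ^ a                          ∎
  geometric y (suc m) a h h≡ = begin
    (1# - y) * (y ^ h 0 + ∑∈ (applyUpTo (h ∘ suc) m) (y ^_)) + y ^ (a ℕ.+ suc m)
      ≈⟨ +-cong (*-congˡ (+-congʳ (^-congʳ y (≡.trans (h≡ 0) (ℕ.+-identityʳ a)))))
                (^-congʳ y (ℕ.+-suc a m)) ⟩
    (1# - y) * (y ^ a + ∑∈ (applyUpTo (h ∘ suc) m) (y ^_)) + y ^ (suc a ℕ.+ m)
      ≈⟨ solve 4 (λ y b s t → (:1 :- y) :* (b :+ s) :+ t := ((:1 :- y) :* s :+ t) :+ (b :- y :* b))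
               refl y (y ^ a) _ _ ⟩
    ((1# - y) * ∑∈ (applyUpTo (h ∘ suc) m) (y ^_) + y ^ (suc a ℕ.+ m)) + (y ^ a - y ^ suc a)
      ≈⟨ +-congʳ (geometric y m (suc a) (h ∘ suc) (λ j → ≡.trans (h≡ (suc j)) (ℕ.+-suc a j))) ⟩
    y ^ suc a + (y ^ a - y ^ suc a)
      ≈⟨ solve 2 (λ a b → a :+ (b :- a) := b) refl _ _ ⟩
    y ^ a ∎

  -- Since y + 2y²/(1 - y) = y(1 + y)/(1 - y), and y^(n+1) = 0 removes the tail of the geometric
  -- series.
  ρ-equation : ∀ y → y ^ suc n ≈ 0# → (1# - y) * ρ y ≈ y * (1# + y)
  ρ-equation y y^n≈0 = begin
    (1# - y) * (y + τ y + τ y)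
      ≈⟨ solve 2 (λ y t → (:1 :- y) :* (y :+ t :+ t) :=
                          (:1 :- y) :* y :+ (:1 :- y) :* t :+ (:1 :- y) :* t) refl y (τ y) ⟩
    (1# - y) * y + (1# - y) * τ y + (1# - y) * τ y
      ≈⟨ +-cong (+-congˡ eq) eq ⟩
    (1# - y) * y + y ^ 2 + y ^ 2
      ≈⟨ solve 1 (λ y → (:1 :- y) :* y :+ y :^ 2 :+ y :^ 2 := y :* (:1 :+ y)) refl y ⟩
    y * (1# + y) ∎
    where
    eq : (1# - y) * τ y ≈ y ^ 2
    eq = begin
      (1# - y) * τ y                  ≈⟨ +-identityʳ _ ⟨
      (1# - y) * τ y + 0#             ≈⟨ +-congˡ y^n≈0 ⟨
      (1# - y) * τ y + y ^ (2 ℕ.+ N)  ≈⟨ geometric y N 2 (suc ∘ suc) (λ _ → ≡.refl) ⟩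
      y ^ 2                           ∎

  [q^[1+p]]^[1+n]≈0 : ∀ p → (q ^ suc p) ^ suc n ≈ 0#
  [q^[1+p]]^[1+n]≈0 p = begin
    (q ^ suc p) ^ suc n           ≈⟨ ^-assocʳ q (suc p) (suc n) ⟩
    q ^ (suc n ℕ.+ p ℕ.* suc n)   ≈⟨ ^-congʳ q (ℕ.+-comm (suc n) (p ℕ.* suc n)) ⟩
    q ^ (p ℕ.* suc n ℕ.+ suc n)   ≈⟨ q^[1+p+n]≈0 (p ℕ.* suc n) ⟩
    0#                            ∎

  -- The coefficients of the series F

  -- ρ (q^k) = q^k (1 + q^k) / (1 - q^k), so u p x = (-x)^p q^(p(p+1)/2) (-q;q)_p / (q;q)_p.
  u : ℕ → Carrier → Carrier
  u zero    x = 1#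
  u (suc p) x = - x * ρ (q ^ suc p) * u p x

  u-cong : ∀ p {x y} → x ≈ y → u p x ≈ u p y
  u-cong zero    x≈y = refl
  u-cong (suc p) x≈y = *-cong (*-congʳ (-‿cong x≈y)) (u-cong p x≈y)

  u-zero : ∀ p → u (suc p) 0# ≈ 0#
  u-zero p = begin
    - 0# * ρ (q ^ suc p) * u p 0#  ≈⟨ *-congʳ (*-congʳ -0#≈0#) ⟩
    0# * ρ (q ^ suc p) * u p 0#    ≈⟨ trans (*-congʳ (zeroˡ _)) (zeroˡ _) ⟩
    0#                             ∎

  -- `u p` is homogeneous of degree p in x.
  u-shift : ∀ p x → u p (x * q) ≈ q ^ p * u p x
  u-shift zero    x = sym (*-identityˡ 1#)
  u-shift (suc p) x = begin
    - (x * q) * ρ (q ^ suc p) * u p (x * q)    ≈⟨ *-congˡ (u-shift p x) ⟩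
    - (x * q) * ρ (q ^ suc p) * (q ^ p * u p x)
      ≈⟨ solve 5 (λ x q r y u → (:- (x :* q)) :* r :* (y :* u) :=
                                  (q :* y) :* ((:- x) :* r :* u)) refl x q _ (q ^ p) _ ⟩
    q ^ suc p * (- x * ρ (q ^ suc p) * u p x)  ∎

  -- The ratio of consecutive terms with its denominator cleared, the form in which the telescoping
  -- uses it.
  u-step : ∀ p x → (1# - q ^ suc p) * u (suc p) x ≈ - x * (q ^ suc p * (1# + q ^ suc p)) * u p x
  u-step p x = begin
    (1# - q ^ suc p) * (- x * ρ (q ^ suc p) * u p x)
      ≈⟨ solve 4 (λ a x r u → a :* (x :* r :* u) := x :* (a :* r) :* u) refl _ (- x) _ _ ⟩
    - x * ((1# - q ^ suc p) * ρ (q ^ suc p)) * u p x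
      ≈⟨ *-congʳ (*-congˡ (ρ-equation _ ([q^[1+p]]^[1+n]≈0 p))) ⟩
    - x * (q ^ suc p * (1# + q ^ suc p)) * u p x ∎

  -- In `u-step` with p = n the left factor 1 - q^(n+1) is 1 while the right side contains q^(n+1) =
  -- 0. Hence the series F may stop at the term p = n.
  u-last : ∀ x → u (suc n) x ≈ 0#
  u-last x = begin
    u (suc n) x                       ≈⟨ *-identityˡ _ ⟨
    1# * u (suc n) x                  ≈⟨ *-congʳ (trans (+-congˡ -0#≈0#) (+-identityʳ 1#)) ⟨
    (1# - 0#) * u (suc n) x           ≈⟨ *-congʳ (+-congˡ (-‿cong q-nilpotent)) ⟨
    (1# - q ^ suc n) * u (suc n) x    ≈⟨ u-step n x ⟩
    - x * (q ^ suc n * (1# + q ^ suc n)) * u n x  ≈⟨ *-congʳ (*-congˡ (trans (*-congʳ q-nilpotent) (zeroˡ _))) ⟩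
    - x * 0# * u n x                  ≈⟨ trans (*-congʳ (zeroʳ _)) (zeroˡ _) ⟩
    0#                                ∎

  -- The series F and its functional equation

  F : ℕ → Carrier → Carrier
  F zero    x = 0#
  F (suc m) x = F m x + u m x * ∏ (x * q ^ m)

  F-cong : ∀ m {x y} → x ≈ y → F m x ≈ F m y
  F-cong zero    x≈y = refl
  F-cong (suc m) x≈y = +-cong (F-cong m x≈y) (*-cong (u-cong m x≈y) (∏-cong n (*-congʳ x≈y)))

  F-zero : ∀ m → F (suc m) 0# ≈ 1#
  F-zero zero    = begin
    0# + 1# * ∏ (0# * 1#)  ≈⟨ trans (+-identityˡ _) (*-identityˡ _) ⟩
    ∏ (0# * 1#)            ≈⟨ ∏-cong n (zeroˡ _) ⟩
    ∏ 0#                   ≈⟨ ∏-zero n ⟩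
    1#                     ∎
  F-zero (suc m) = begin
    F (suc m) 0# + u (suc m) 0# * ∏ (0# * q ^ suc m)  ≈⟨ +-cong (F-zero m) (trans (*-congʳ (u-zero m)) (zeroˡ _)) ⟩
    1# + 0#                                           ≈⟨ +-identityʳ 1# ⟩
    1#                                                ∎

  -- With the last term as remainder, each summand of the functional equation is a difference of
  -- consecutive remainders. The factor 1 - q^m makes the remainder vanish at m = 0.
  F-telescope : ∀ m x →
    F m x + (1# - x * q) * (x * q * q) * F m (x * q * q) ≈
    F m (x * q) - (1# - q ^ m) * u m x * ∏ (x * q ^ m * q)
  F-telescope zero    x =
    begin
    0# + (1# - x * q) * (x * q * q) * 0#  ≈⟨ +-congˡ (zeroʳ _) ⟩
    0# + 0#                               ≈⟨ +-congˡ (trans (-‿cong vanish) -0#≈0#) ⟨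
    0# - (1# - 1#) * 1# * ∏ (x * 1# * q)  ∎
    where
    vanish : (1# - 1#) * 1# * ∏ (x * 1# * q) ≈ 0#
    vanish = trans (*-congʳ (trans (*-congʳ (-‿inverseʳ 1#)) (zeroˡ _))) (zeroˡ _)
  F-telescope (suc m) x = begin
    (F m x + u m x * ∏ t) + c * (F m (x * q * q) + u m (x * q * q) * ∏ (x * q * q * y))
      ≈⟨ +-cong (+-congˡ (*-congˡ A₀)) (*-congˡ (+-congˡ (*-cong u₂ (∏-cong n x₂)))) ⟩
    (F m x + u m x * A) + c * (F m (x * q * q) + y * (y * u m x) * B)
      ≈⟨ solve 5 (λ f a c g b → (f :+ a) :+ c :* (g :+ b) := (f :+ c :* g) :+ (a :+ c :* b)) refl _ _ _ _ _ ⟩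
    (F m x + c * F m (x * q * q)) + (u m x * A + c * (y * (y * u m x) * B))
      ≈⟨ +-congʳ (F-telescope m x) ⟩
    (F m (x * q) - (1# - y) * u m x * ∏ (t * q)) + (u m x * A + c * (y * (y * u m x) * B))
      ≈⟨ +-congʳ (+-congˡ (-‿cong (*-congˡ (∏-unfold (t * q))))) ⟩
    (F m (x * q) - (1# - y) * u m x * ((1# + t * q * q) * B)) + (u m x * A + c * (y * (y * u m x) * B))
      ≈⟨ solve 6 (λ x q y u f B →
           (f :- (:1 :- y) :* u :* ((:1 :+ x :* y :* q :* q) :* B)) :+
           (u :* ((:1 :+ x :* y :* q) :* ((:1 :+ x :* y :* q :* q) :* B)) :+
            (:1 :- x :* q) :* (x :* q :* q) :* (y :* (y :* u) :* B)) :=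
           (f :+ y :* u :* ((:1 :+ x :* y :* q :* q) :* B)) :- (:- x) :* (q :* y :* (:1 :+ q :* y)) :* u :* B)
           refl x q y (u m x) (F m (x * q)) B ⟩
    (F m (x * q) + y * u m x * ((1# + t * q * q) * B)) - - x * (q * y * (1# + q * y)) * u m x * B
      ≈⟨ +-cong (+-congˡ (*-cong (u-shift m x) A₁)) (-‿cong (*-cong (u-step m x) (∏-cong n x₃))) ⟨
    (F m (x * q) + u m (x * q) * ∏ (x * q * y)) - (1# - q ^ suc m) * u (suc m) x * ∏ (x * q ^ suc m * q) ∎
    where
    y = q ^ m
    t = x * y
    c = (1# - x * q) * (x * q * q)
    -- Every product that occurs at stage m is a polynomial multiple of this one, so the induction
    -- step becomes a polynomial identity in x, q and q^m.
    B = ∏ (t * q * q)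
    A = (1# + t * q) * ((1# + t * q * q) * B)
    A₀ : ∏ t ≈ A
    A₀ = trans (∏-unfold t) (*-congˡ (∏-unfold (t * q)))
    A₁ : ∏ (x * q * y) ≈ (1# + t * q * q) * B
    A₁ = trans (∏-cong n (solve 3 (λ x q y → x :* q :* y := x :* y :* q) refl x q y)) (∏-unfold (t * q))
    x₂ : x * q * q * y ≈ t * q * q
    x₂ = solve 3 (λ x q y → x :* q :* q :* y := x :* y :* q :* q) refl x q y
    x₃ : x * q ^ suc m * q ≈ t * q * q
    x₃ = solve 3 (λ x q y → x :* (q :* y) :* q := x :* y :* q :* q) refl x q y
    u₂ : u m (x * q * q) ≈ y * (y * u m x)
    u₂ = trans (u-shift m (x * q)) (*-congˡ (u-shift m x))

  F∞ S : Carrier → Carrier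
  F∞ = F (suc n)
  S x = F∞ x - x * q * F∞ (x * q)

  F∞-functional : ∀ x → F∞ x + (1# - x * q) * (x * q * q) * F∞ (x * q * q) ≈ F∞ (x * q)
  F∞-functional x = begin
    F∞ x + (1# - x * q) * (x * q * q) * F∞ (x * q * q)
      ≈⟨ F-telescope (suc n) x ⟩
    F∞ (x * q) - (1# - q ^ suc n) * u (suc n) x * ∏ (x * q ^ suc n * q)
      ≈⟨ +-congˡ (-‿cong (trans (*-congʳ (trans (*-congˡ (u-last x)) (zeroʳ _))) (zeroˡ _))) ⟩
    F∞ (x * q) - 0#  ≈⟨ trans (+-congˡ -0#≈0#) (+-identityʳ _) ⟩
    F∞ (x * q)       ∎

  -- Replacing F(x) by means of the functional equation leaves 1 - xq as a common factor.
  S-unfold : ∀ x → S x ≈ (1# + - x * q) * S (x * q)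
  S-unfold x = begin
    F∞ x - x * q * F∞ (x * q)
      ≈⟨ solve 5 (λ x q f g h → f :- x :* q :* g :=
            (f :+ (:1 :- x :* q) :* (x :* q :* q) :* h) :-
            (x :* q :* g :+ (:1 :- x :* q) :* (x :* q :* q) :* h)) refl x q _ _ _ ⟩
    (F∞ x + (1# - x * q) * (x * q * q) * F∞ (x * q * q)) -
    (x * q * F∞ (x * q) + (1# - x * q) * (x * q * q) * F∞ (x * q * q))
      ≈⟨ +-congʳ (F∞-functional x) ⟩
    F∞ (x * q) - (x * q * F∞ (x * q) + (1# - x * q) * (x * q * q) * F∞ (x * q * q))
      ≈⟨ solve 4 (λ x q g h → g :- (x :* q :* g :+ (:1 :- x :* q) :* (x :* q :* q) :* h) :=
                     (:1 :+ (:- x) :* q) :* (g :- x :* q :* q :* h)) refl x q _ _ ⟩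
    (1# + - x * q) * S (x * q) ∎

  -- Nilpotency replaces the limit S(x q^m) → S(0) = 1: unfolding m times reaches an argument that
  -- is equal to 0.
  S≈∏ : ∀ m x → x * q ^ m ≈ 0# → S x ≈ ∏ (- x)
  S≈∏ zero x xq^m≈0 = begin
    F∞ x - x * q * F∞ (x * q)   ≈⟨ +-cong (trans (F-cong (suc n) x≈0) (F-zero n))
                                           (-‿cong (trans (*-congʳ (trans (*-congʳ x≈0) (zeroˡ q))) (zeroˡ _))) ⟩
    1# - 0#                     ≈⟨ trans (+-congˡ -0#≈0#) (+-identityʳ 1#) ⟩
    1#                          ≈⟨ ∏-zero n ⟨
    ∏ 0#                        ≈⟨ ∏-cong n (trans (-‿cong x≈0) -0#≈0#) ⟨
    ∏ (- x)                     ∎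
    where
    x≈0 : x ≈ 0#
    x≈0 = trans (sym (*-identityʳ x)) xq^m≈0
  S≈∏ (suc m) x xq^m≈0 = begin
    S x                                ≈⟨ S-unfold x ⟩
    (1# + - x * q) * S (x * q)         ≈⟨ *-congˡ (S≈∏ m (x * q) (trans (*-assoc x q _) xq^m≈0)) ⟩
    (1# + - x * q) * ∏ (- (x * q))     ≈⟨ *-congˡ (∏-cong n (-‿distribˡ-* x q)) ⟩
    (1# + - x * q) * ∏ (- x * q)       ≈⟨ ∏-unfold (- x) ⟨
    ∏ (- x)                            ∎

  F∞-unfold : ∀ x → F∞ x ≈ ∏ (- x) + x * q * F∞ (x * q)
  F∞-unfold x = begin
    F∞ x                          ≈⟨ solve 2 (λ f g → f := (f :- g) :+ g) refl _ _ ⟩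
    S x + x * q * F∞ (x * q)      ≈⟨ +-congʳ (S≈∏ (suc n) x (trans (*-congˡ q-nilpotent) (zeroʳ x))) ⟩
    ∏ (- x) + x * q * F∞ (x * q)  ∎

  -- Rules for finite sums

  ∑∈-cong : {A : Set} (as : List A) {g h : A → Carrier} → (∀ a → g a ≈ h a) → ∑∈ as g ≈ ∑∈ as h
  ∑∈-cong []       g≈h = refl
  ∑∈-cong (a ∷ as) g≈h = +-cong (g≈h a) (∑∈-cong as g≈h)

  ∑∈-++ : {A : Set} (as bs : List A) (g : A → Carrier) → ∑∈ (as ++ bs) g ≈ ∑∈ as g + ∑∈ bs g
  ∑∈-++ []       bs g = sym (+-identityˡ _)
  ∑∈-++ (a ∷ as) bs g = trans (+-congˡ (∑∈-++ as bs g)) (sym (+-assoc _ _ _))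

  ∑∈-map : {A B : Set} (h : A → B) (as : List A) (g : B → Carrier) → ∑∈ (map h as) g ≈ ∑∈ as (g ∘ h)
  ∑∈-map h []       g = refl
  ∑∈-map h (a ∷ as) g = +-congˡ (∑∈-map h as g)

  ∑∈-concatMap : {A B : Set} (h : A → List B) (as : List A) (g : B → Carrier) →
                 ∑∈ (concatMap h as) g ≈ ∑∈ as (λ a → ∑∈ (h a) g)
  ∑∈-concatMap h []       g = refl
  ∑∈-concatMap h (a ∷ as) g = trans (∑∈-++ (h a) _ g) (+-congˡ (∑∈-concatMap h as g))

  -- Agreement is asked only on the values of `h`: in `GF-split` the weights are known to agree only
  -- for multiplicities at least 2.
  ∑∈-applyUpTo-cong : {A : Set} (h : ℕ → A) (m : ℕ) {g g′ : A → Carrier} → (∀ j → g (h j) ≈ g′ (h j)) →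
                      ∑∈ (applyUpTo h m) g ≈ ∑∈ (applyUpTo h m) g′
  ∑∈-applyUpTo-cong h zero    g≈g′ = refl
  ∑∈-applyUpTo-cong h (suc m) g≈g′ = +-cong (g≈g′ 0) (∑∈-applyUpTo-cong (h ∘ suc) m (g≈g′ ∘ suc))

  ∑∈-*ˡ : {A : Set} (as : List A) (c : Carrier) (g : A → Carrier) → ∑∈ as (λ a → c * g a) ≈ c * ∑∈ as g
  ∑∈-*ˡ []       c g = sym (zeroʳ c)
  ∑∈-*ˡ (a ∷ as) c g = trans (+-congˡ (∑∈-*ˡ as c g)) (sym (distribˡ c _ _))

  ∑∈-*ʳ : {A : Set} (as : List A) (c : Carrier) (g : A → Carrier) → ∑∈ as (λ a → g a * c) ≈ ∑∈ as g * c
  ∑∈-*ʳ as c g = trans (∑∈-cong as (λ a → *-comm (g a) c)) (trans (∑∈-*ˡ as c g) (*-comm c _))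

  ∑∈-+ : {A : Set} (as : List A) (g h : A → Carrier) → ∑∈ as (λ a → g a + h a) ≈ ∑∈ as g + ∑∈ as h
  ∑∈-+ []       g h = sym (+-identityˡ 0#)
  ∑∈-+ (a ∷ as) g h = trans (+-congˡ (∑∈-+ as g h))
    (solve 4 (λ a b c d → (a :+ b) :+ (c :+ d) := (a :+ c) :+ (b :+ d)) refl _ _ _ _)

  -- Generating functions of weighted frequency lists

  -- The m entries are the multiplicities, each at most n, of the parts k + 1 to k + m.
  GF : (Freq → ℤ) → ℕ → ℕ → Carrier
  GF φ m k = ∑∈ (allLists m n) (λ f → ⟦ φ f ⟧ * q ^ sizeFrom k f)

  GF-linear : ∀ {φ ψ χ} a b m k → (∀ f → φ f ≡ a ℤ.* ψ f ℤ.+ b ℤ.* χ f) →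
              GF φ m k ≈ ⟦ a ⟧ * GF ψ m k + ⟦ b ⟧ * GF χ m k
  GF-linear {φ} {ψ} {χ} a b m k φ≡ = begin
    GF φ m k
      ≈⟨ ∑∈-cong fs (λ f → trans (*-congʳ (trans (reflexive (cong ⟦_⟧ (φ≡ f)))
             (trans (+-homo _ _) (+-cong (*-homo a (ψ f)) (*-homo b (χ f))))))
           (solve 5 (λ a b p x t → (a :* p :+ b :* x) :* t := a :* (p :* t) :+ b :* (x :* t)) refl _ _ _ _ _)) ⟩
    ∑∈ fs (λ f → ⟦ a ⟧ * (⟦ ψ f ⟧ * q ^ sizeFrom k f) + ⟦ b ⟧ * (⟦ χ f ⟧ * q ^ sizeFrom k f))
      ≈⟨ ∑∈-+ fs _ _ ⟩
    _ ≈⟨ +-cong (∑∈-*ˡ fs _ _) (∑∈-*ˡ fs _ _) ⟩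
    ⟦ a ⟧ * GF ψ m k + ⟦ b ⟧ * GF χ m k ∎
    where
    fs = allLists m n

  GF-cong : ∀ {φ ψ} m k → (∀ f → φ f ≡ ψ f) → GF φ m k ≈ GF ψ m k
  GF-cong m k φ≡ψ = ∑∈-cong (allLists m n) (λ f → *-congʳ (reflexive (cong ⟦_⟧ (φ≡ψ f))))

  GF-∷ : ∀ φ m k → GF φ (suc m) k ≈
         ∑∈ (upTo (suc n)) (λ x → (q ^ suc k) ^ x * GF (φ ∘ (x ∷_)) m (suc k))
  GF-∷ φ m k = begin
    GF φ (suc m) k
      ≈⟨ ∑∈-concatMap (λ x → map (x ∷_) fs) (upTo (suc n)) _ ⟩
    ∑∈ (upTo (suc n)) (λ x → ∑∈ (map (x ∷_) fs) (λ f → ⟦ φ f ⟧ * q ^ sizeFrom k f))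
      ≈⟨ ∑∈-cong (upTo (suc n)) first-part ⟩
    ∑∈ (upTo (suc n)) (λ x → (q ^ suc k) ^ x * GF (φ ∘ (x ∷_)) m (suc k)) ∎
    where
    fs = allLists m n
    first-part : ∀ x → ∑∈ (map (x ∷_) fs) (λ f → ⟦ φ f ⟧ * q ^ sizeFrom k f) ≈
                       (q ^ suc k) ^ x * GF (φ ∘ (x ∷_)) m (suc k)
    first-part x = begin
      ∑∈ (map (x ∷_) fs) (λ f → ⟦ φ f ⟧ * q ^ sizeFrom k f)
        ≈⟨ ∑∈-map _ fs _ ⟩
      ∑∈ fs (λ f → ⟦ φ (x ∷ f) ⟧ * q ^ (suc k ℕ.* x ℕ.+ sizeFrom (suc k) f))
        ≈⟨ ∑∈-cong fs (λ f → trans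
             (*-congˡ (trans (^-homo-* q (suc k ℕ.* x) _) (*-congʳ (sym (^-assocʳ q (suc k) x)))))
             (solve 3 (λ a b c → a :* (b :* c) := b :* (a :* c)) refl _ _ _)) ⟩
      ∑∈ fs (λ f → (q ^ suc k) ^ x * (⟦ φ (x ∷ f) ⟧ * q ^ sizeFrom (suc k) f))
        ≈⟨ ∑∈-*ˡ fs _ _ ⟩
      (q ^ suc k) ^ x * GF (φ ∘ (x ∷_)) m (suc k) ∎

  -- A weight that does not distinguish multiplicities 2, 3, ... of the first part lets their powers
  -- of q be summed separately, to `τ`.
  GF-split : ∀ φ ψ m k → (∀ x f → φ (suc (suc x) ∷ f) ≡ ψ f) →
             GF φ (suc m) k ≈ GF (φ ∘ (0 ∷_)) m (suc k) + q ^ suc k * GF (φ ∘ (1 ∷_)) m (suc k)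
                              + τ (q ^ suc k) * GF ψ m (suc k)
  GF-split φ ψ m k φ≡ψ = begin
    GF φ (suc m) k
      ≈⟨ GF-∷ φ m k ⟩
    1# * G 0 + (y * 1# * G 1 + ∑∈ (applyUpTo (suc ∘ suc) N) (λ x → y ^ x * G x))
      ≈⟨ solve 4 (λ a y b c → :1 :* a :+ (y :* :1 :* b :+ c) := a :+ y :* b :+ c) refl _ _ _ _ ⟩
    G 0 + y * G 1 + ∑∈ (applyUpTo (suc ∘ suc) N) (λ x → y ^ x * G x)
      ≈⟨ +-congˡ (trans (∑∈-applyUpTo-cong (suc ∘ suc) N (λ x → *-congˡ (GF-cong m (suc k) (φ≡ψ x))))
                        (∑∈-*ʳ (applyUpTo (suc ∘ suc) N) _ (y ^_))) ⟩
    G 0 + y * G 1 + τ y * GF ψ m (suc k) ∎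
    where
    y = q ^ suc k
    G : ℕ → Carrier
    G x = GF (φ ∘ (x ∷_)) m (suc k)

  xq^n*q≈0 : ∀ x → x * q ^ n * q ≈ 0#
  xq^n*q≈0 x = begin
    x * q ^ n * q  ≈⟨ solve 3 (λ x y q → x :* y :* q := x :* (q :* y)) refl x (q ^ n) q ⟩
    x * q ^ suc n  ≈⟨ trans (*-congˡ q-nilpotent) (zeroʳ x) ⟩
    0#             ∎

  ∏[xq^n]≈1 : ∀ x → ∏ (x * q ^ n) ≈ 1#
  ∏[xq^n]≈1 x = begin
    ∏ (x * q ^ n)                                 ≈⟨ ∏-unfold _ ⟩
    (1# + x * q ^ n * q) * ∏ (x * q ^ n * q)      ≈⟨ *-cong (+-congˡ (xq^n*q≈0 x)) (∏-cong n (xq^n*q≈0 x)) ⟩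
    (1# + 0#) * ∏ 0#                              ≈⟨ *-cong (+-identityʳ 1#) (∏-zero n) ⟩
    1# * 1#                                       ≈⟨ *-identityˡ 1# ⟩
    1#                                            ∎

  xq^k*q : ∀ x k → x * q ^ suc k ≈ x * q ^ k * q
  xq^k*q x k = solve 3 (λ x q y → x :* (q :* y) := x :* y :* q) refl x q (q ^ k)

  GF-[] : ∀ φ k → φ [] ≡ + 1 → GF φ 0 k ≈ 1#
  GF-[] φ k φ[]≡1 = begin
    ⟦ φ [] ⟧ * 1# + 0#  ≈⟨ trans (+-identityʳ _) (*-identityʳ _) ⟩
    ⟦ φ [] ⟧            ≈⟨ trans (reflexive (cong ⟦_⟧ φ[]≡1)) 1-homo ⟩
    1#                  ∎

  m+1+k : ∀ {m k} → suc m ℕ.+ k ≡ n → m ℕ.+ suc k ≡ n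
  m+1+k {m} {k} eq = ≡.trans (ℕ.+-suc m k) eq

  -- The recurrences for both sides, solved by F

  module _ {ζ c δ φ} (rec : ChainRecurrence ζ c δ φ) where
    open ChainRecurrence rec

    -- The condition m + k = n makes n the largest part; the factors of `∏` belonging to larger
    -- parts are all 1.
    GF-δ : ∀ m k → m ℕ.+ k ≡ n → GF δ m k ≈ ∏ (⟦ ζ ⟧ * q ^ k)
    GF-δ zero    k ≡.refl = trans (GF-[] δ k δ-[]) (sym (∏[xq^n]≈1 ⟦ ζ ⟧))
    GF-δ (suc m) k eq     = begin
      GF δ (suc m) k
        ≈⟨ GF-split δ (λ _ → + 0) m k δ-2 ⟩
      GF (δ ∘ (0 ∷_)) m (suc k) + y * GF (δ ∘ (1 ∷_)) m (suc k) + τ y * GF (λ _ → + 0) m (suc k)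
        -- A scalar multiple and the zero weight are both written as linear combinations with zero
        -- coefficients.
        ≈⟨ +-cong (+-cong (GF-cong m (suc k) δ-0)
             (*-congˡ (GF-linear ζ (+ 0) m (suc k) (λ f → ≡.trans (δ-1 f) (≡.sym (ℤ.+-identityʳ _))))))
             (*-congˡ (GF-linear {ψ = δ} {χ = δ} (+ 0) (+ 0) m (suc k) (λ _ → ≡.refl))) ⟩
      D + y * (⟦ ζ ⟧ * D + ⟦ + 0 ⟧ * D) + τ y * (⟦ + 0 ⟧ * D + ⟦ + 0 ⟧ * D)
        ≈⟨ solve 5 (λ z q y t d →
             d :+ q :* y :* (z :* d :+ con (+ 0) :* d) :+ t :* (con (+ 0) :* d :+ con (+ 0) :* d)
             := (:1 :+ z :* y :* q) :* d) refl ⟦ ζ ⟧ q (q ^ k) _ _ ⟩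
      (1# + ⟦ ζ ⟧ * q ^ k * q) * D
        ≈⟨ *-congˡ (trans (GF-δ m (suc k) (m+1+k eq)) (∏-cong n (xq^k*q ⟦ ζ ⟧ k))) ⟩
      (1# + ⟦ ζ ⟧ * q ^ k * q) * ∏ (⟦ ζ ⟧ * q ^ k * q)
        ≈⟨ ∏-unfold _ ⟨
      ∏ (⟦ ζ ⟧ * q ^ k) ∎
      where
      y = q ^ suc k
      D = GF δ m (suc k)

    -- The `δ` terms from multiplicities 0 and 1 combine to the product; the `φ` terms from
    -- multiplicity 1 and from `τ` give the factor of the next sum.
    GF-φ : ∀ m k → suc m ℕ.+ k ≡ n →
           GF φ (suc m) k ≈ ∏ (⟦ ζ ⟧ * q ^ k) + (⟦ c ⟧ * τ (q ^ suc k) - ⟦ ζ ⟧ * q ^ suc k) * GF φ m (suc k)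
    GF-φ m k eq = begin
      GF φ (suc m) k
        ≈⟨ GF-split φ (λ f → c ℤ.* φ f) m k φ-2 ⟩
      GF (φ ∘ (0 ∷_)) m (suc k) + y * GF (φ ∘ (1 ∷_)) m (suc k) + τ y * GF (λ f → c ℤ.* φ f) m (suc k)
        ≈⟨ +-cong (+-cong (GF-cong m (suc k) φ-0)
             (*-congˡ (trans (GF-linear {ψ = δ} {χ = φ} ζ (ℤ.- ζ) m (suc k) φ-1′) (+-congˡ (*-congʳ (-‿homo ζ))))))
             (*-congˡ (GF-linear {ψ = φ} {χ = φ} c (+ 0) m (suc k) (λ f → ≡.sym (ℤ.+-identityʳ _)))) ⟩
      D + y * (⟦ ζ ⟧ * D + - ⟦ ζ ⟧ * W) + τ y * (⟦ c ⟧ * W + ⟦ + 0 ⟧ * W)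
        ≈⟨ solve 7 (λ z c q y t d w →
             d :+ q :* y :* (z :* d :+ (:- z) :* w) :+ t :* (c :* w :+ con (+ 0) :* w)
             := (:1 :+ z :* y :* q) :* d :+ (c :* t :- z :* (q :* y)) :* w) refl ⟦ ζ ⟧ ⟦ c ⟧ q (q ^ k) _ _ _ ⟩
      (1# + ⟦ ζ ⟧ * q ^ k * q) * D + _
        ≈⟨ +-congʳ (*-congˡ (trans (GF-δ m (suc k) (m+1+k eq)) (∏-cong n (xq^k*q ⟦ ζ ⟧ k)))) ⟩
      (1# + ⟦ ζ ⟧ * q ^ k * q) * ∏ (⟦ ζ ⟧ * q ^ k * q) + _
        ≈⟨ +-congʳ (∏-unfold _) ⟨
      ∏ (⟦ ζ ⟧ * q ^ k) + (⟦ c ⟧ * τ y - ⟦ ζ ⟧ * y) * W ∎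
      where
      y = q ^ suc k
      D = GF δ m (suc k)
      W = GF φ m (suc k)
      φ-1′ : ∀ f → φ (1 ∷ f) ≡ ζ ℤ.* δ f ℤ.+ ℤ.- ζ ℤ.* φ f
      φ-1′ f = ≡.trans (φ-1 f) (≡.trans (ℤ.*-distribˡ-+ ζ (δ f) _)
        (cong (λ a → ζ ℤ.* δ f ℤ.+ a) (≡.trans (≡.sym (ℤ.neg-distribʳ-* ζ (φ f))) (ℤ.neg-distribˡ-* ζ (φ f)))))

  -- An invariant of unrolling the recurrence: k terms of F are already split off, and the remaining
  -- sum carries the factor `u k`. At k = n the remaining sum is 1 and supplies the last term.
  GF-chains : ∀ {ζ δ φ} → ChainRecurrence ζ (ℤ.- (+ 2 ℤ.* ζ)) δ φ → ∀ m k → m ℕ.+ k ≡ n →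
              F k ⟦ ζ ⟧ + u k ⟦ ζ ⟧ * GF φ m k ≈ F∞ ⟦ ζ ⟧
  GF-chains {ζ} {φ = φ} rec zero    k ≡.refl =
    +-congˡ (*-congˡ (trans (GF-[] φ k (ChainRecurrence.φ-[] rec)) (sym (∏[xq^n]≈1 ⟦ ζ ⟧))))
  GF-chains {ζ} {φ = φ} rec (suc m) k eq = begin
    F k z + u k z * GF φ (suc m) k
      ≈⟨ +-congˡ (*-congˡ (GF-φ rec m k eq)) ⟩
    F k z + u k z * (∏ (z * q ^ k) + (⟦ ℤ.- (+ 2 ℤ.* ζ) ⟧ * τ y - z * y) * W)
      ≈⟨ +-congˡ (*-congˡ (+-congˡ (*-congʳ (+-congʳ (*-congʳ (trans (-‿homo _) (-‿cong (*-homo (+ 2) ζ)))))))) ⟩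
    F k z + u k z * (∏ (z * q ^ k) + (- (⟦ + 2 ⟧ * z) * τ y - z * y) * W)
      -- For c = -2ζ the factor c τ(y) - ζ y is -ζ ρ(y), which turns `u k` into `u (suc k)`.
      ≈⟨ solve 7 (λ z y t f u p w → f :+ u :* (p :+ ((:- (con (+ 2) :* z)) :* t :- z :* y) :* w)
                    := (f :+ u :* p) :+ (:- z) :* (y :+ t :+ t) :* u :* w) refl z y (τ y) _ _ _ _ ⟩
    F (suc k) z + u (suc k) z * W
      ≈⟨ GF-chains rec m (suc k) (m+1+k eq) ⟩
    F∞ z ∎
    where
    z = ⟦ ζ ⟧
    y = q ^ suc k
    W = GF φ m (suc k)

  -- With sign -ζ and c = 0 the recurrence is that of `F∞-unfold` at x = ζ q^k, and both sides are 1
  -- at k = n.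
  GF-distinct : ∀ {ζ δ φ} → ChainRecurrence (ℤ.- ζ) (+ 0) δ φ → ∀ m k → m ℕ.+ k ≡ n →
                GF φ m k ≈ F∞ (⟦ ζ ⟧ * q ^ k)
  GF-distinct {ζ} {φ = φ} rec zero    k ≡.refl = begin
    GF φ 0 n                                ≈⟨ GF-[] φ n (ChainRecurrence.φ-[] rec) ⟩
    1#                                      ≈⟨ ∏[xq^n]≈1 (- z) ⟨
    ∏ (- z * q ^ n)                         ≈⟨ ∏-cong n (-‿distribˡ-* z _) ⟨
    ∏ (- (z * q ^ n))                       ≈⟨ trans (+-congˡ (trans (*-congʳ (xq^n*q≈0 z)) (zeroˡ _))) (+-identityʳ _) ⟨
    ∏ (- (z * q ^ n)) + z * q ^ n * q * _   ≈⟨ F∞-unfold (z * q ^ n) ⟨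
    F∞ (z * q ^ n)                          ∎
    where
    z = ⟦ ζ ⟧
  GF-distinct {ζ} {φ = φ} rec (suc m) k eq = begin
    GF φ (suc m) k
      ≈⟨ GF-φ rec m k eq ⟩
    ∏ (⟦ ℤ.- ζ ⟧ * q ^ k) + (⟦ + 0 ⟧ * τ y - ⟦ ℤ.- ζ ⟧ * y) * L
      ≈⟨ +-cong (∏-cong n (trans (*-congʳ (-‿homo ζ)) (sym (-‿distribˡ-* z _))))
                (*-congʳ (+-congˡ (-‿cong (*-congʳ (-‿homo ζ))))) ⟩
    ∏ (- (z * q ^ k)) + (⟦ + 0 ⟧ * τ y - - z * y) * L
      ≈⟨ solve 6 (λ z q y t p l → p :+ (con (+ 0) :* t :- (:- z) :* (q :* y)) :* l := p :+ z :* y :* q :* l)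
               refl z q (q ^ k) _ _ _ ⟩
    ∏ (- (z * q ^ k)) + z * q ^ k * q * L
      ≈⟨ +-congˡ (*-congˡ (trans (GF-distinct rec m (suc k) (m+1+k eq)) (F-cong (suc n) (xq^k*q z k)))) ⟩
    ∏ (- (z * q ^ k)) + z * q ^ k * q * F∞ (z * q ^ k * q)
      ≈⟨ F∞-unfold (z * q ^ k) ⟨
    F∞ (z * q ^ k) ∎
    where
    z = ⟦ ζ ⟧
    y = q ^ suc k
    L = GF φ m (suc k)

  GF-equal : ∀ {ζ δ φ δ′ φ′} → ChainRecurrence (ℤ.- ζ) (+ 0) δ φ →
             ChainRecurrence ζ (ℤ.- (+ 2 ℤ.* ζ)) δ′ φ′ → GF φ n 0 ≈ GF φ′ n 0
  GF-equal {ζ} {φ = φ} {φ′ = φ′} rec rec′ = begin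
    GF φ n 0             ≈⟨ GF-distinct rec n 0 (ℕ.+-identityʳ n) ⟩
    F∞ (⟦ ζ ⟧ * 1#)      ≈⟨ F-cong (suc n) (*-identityʳ ⟦ ζ ⟧) ⟩
    F∞ ⟦ ζ ⟧             ≈⟨ GF-chains rec′ n 0 (ℕ.+-identityʳ n) ⟨
    0# + 1# * GF φ′ n 0  ≈⟨ trans (+-identityˡ _) (*-identityˡ _) ⟩
    GF φ′ n 0            ∎

open ≡ using (refl; sym; trans)

-- Formal power series with integer coefficients

module PowerSeries where

  Series : Set
  Series = ℕ → ℤ

  const : ℤ → Series
  const c zero    = c
  const c (suc _) = + 0

  infixl 6 _⊕_
  infixl 7 _⊛_

  _⊕_ _⊛_ : Series → Series → Series
  (f ⊕ g) m = f m ℤ.+ g m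
  (f ⊛ g) zero    = f 0 ℤ.* g 0
  (f ⊛ g) (suc m) = f 0 ℤ.* g (suc m) ℤ.+ (f ∘ suc ⊛ g) m

  -- The coefficient of degree m sees no coefficient of higher degree; this makes multiplication
  -- compatible with truncation.
  ⊛-cong-≤ : ∀ m {f f′ g g′ : Series} → (∀ j → j ≤ m → f j ≡ f′ j) → (∀ j → j ≤ m → g j ≡ g′ j) →
             (f ⊛ g) m ≡ (f′ ⊛ g′) m
  ⊛-cong-≤ zero    f≡f′ g≡g′ = cong₂ ℤ._*_ (f≡f′ 0 z≤n) (g≡g′ 0 z≤n)
  ⊛-cong-≤ (suc m) f≡f′ g≡g′ = cong₂ ℤ._+_
    (cong₂ ℤ._*_ (f≡f′ 0 z≤n) (g≡g′ (suc m) ℕ.≤-refl))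
    (⊛-cong-≤ m (λ j j≤m → f≡f′ (suc j) (s≤s j≤m)) (λ j j≤m → g≡g′ j (ℕ.m≤n⇒m≤1+n j≤m)))

  ⊛-zeroˡ : ∀ g m → ((λ _ → + 0) ⊛ g) m ≡ + 0
  ⊛-zeroˡ g zero    = refl
  ⊛-zeroˡ g (suc m) = trans (ℤ.+-identityˡ _) (⊛-zeroˡ g m)

  const-⊛ : ∀ c g m → (const c ⊛ g) m ≡ c ℤ.* g m
  const-⊛ c g zero    = refl
  const-⊛ c g (suc m) = trans (cong (ℤ._+_ (c ℤ.* g (suc m))) (⊛-zeroˡ g m)) (ℤ.+-identityʳ _)

  -- The product recurses on its left factor; splitting off the opposite end of the convolution is
  -- what commutativity requires.
  ⊛-snoc : ∀ f g m → (f ⊛ g) (suc m) ≡ (f ⊛ (g ∘ suc)) m ℤ.+ f (suc m) ℤ.* g 0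
  ⊛-snoc f g zero    = refl
  ⊛-snoc f g (suc m) = trans
    (cong (ℤ._+_ (f 0 ℤ.* g (suc (suc m)))) (⊛-snoc (f ∘ suc) g m))
    (sym (ℤ.+-assoc (f 0 ℤ.* g (suc (suc m))) _ _))

  ⊛-comm : ∀ f g m → (f ⊛ g) m ≡ (g ⊛ f) m
  ⊛-comm f g zero    = ℤ.*-comm (f 0) (g 0)
  ⊛-comm f g (suc m) = trans (⊛-snoc f g m) (trans (ℤ.+-comm _ (f (suc m) ℤ.* g 0))
    (cong₂ ℤ._+_ (ℤ.*-comm (f (suc m)) (g 0)) (⊛-comm f (g ∘ suc) m)))

  ⊛-distribʳ : ∀ h f g m → ((f ⊕ g) ⊛ h) m ≡ (f ⊛ h) m ℤ.+ (g ⊛ h) m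
  ⊛-distribʳ h f g zero    = ℤ.*-distribʳ-+ (h 0) (f 0) (g 0)
  ⊛-distribʳ h f g (suc m) = trans
    (cong (ℤ._+_ ((f 0 ℤ.+ g 0) ℤ.* h (suc m))) (⊛-distribʳ h (f ∘ suc) (g ∘ suc) m))
    (regroup (f 0) (g 0) (h (suc m)) _ _)
    where
    regroup : ∀ a b c d e → (a ℤ.+ b) ℤ.* c ℤ.+ (d ℤ.+ e) ≡ (a ℤ.* c ℤ.+ d) ℤ.+ (b ℤ.* c ℤ.+ e)
    regroup = solve-∀

  ⊛-distribˡ : ∀ h f g m → (h ⊛ (f ⊕ g)) m ≡ (h ⊛ f) m ℤ.+ (h ⊛ g) m
  ⊛-distribˡ h f g m = trans (⊛-comm h (f ⊕ g) m)
    (trans (⊛-distribʳ h f g m) (cong₂ ℤ._+_ (⊛-comm f h m) (⊛-comm g h m)))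

  ⊛-scaleˡ : ∀ c f g m → ((λ j → c ℤ.* f j) ⊛ g) m ≡ c ℤ.* (f ⊛ g) m
  ⊛-scaleˡ c f g zero    = ℤ.*-assoc c (f 0) (g 0)
  ⊛-scaleˡ c f g (suc m) = trans
    (cong₂ ℤ._+_ (ℤ.*-assoc c (f 0) (g (suc m))) (⊛-scaleˡ c (f ∘ suc) g m))
    (sym (ℤ.*-distribˡ-+ c _ _))

  ⊛-assoc : ∀ f g h m → ((f ⊛ g) ⊛ h) m ≡ (f ⊛ (g ⊛ h)) m
  ⊛-assoc f g h zero    = ℤ.*-assoc (f 0) (g 0) (h 0)
  ⊛-assoc f g h (suc m) = trans
    (cong (ℤ._+_ (f 0 ℤ.* g 0 ℤ.* h (suc m)))
      (trans (⊛-distribʳ h (λ j → f 0 ℤ.* g (suc j)) (f ∘ suc ⊛ g) m)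
        (cong₂ ℤ._+_ (⊛-scaleˡ (f 0) (g ∘ suc) h m) (⊛-assoc (f ∘ suc) g h m))))
    (regroup (f 0) (g 0) (h (suc m)) _ _)
    where
    regroup : ∀ a b c d e → a ℤ.* b ℤ.* c ℤ.+ (a ℤ.* d ℤ.+ e) ≡ a ℤ.* (b ℤ.* c ℤ.+ d) ℤ.+ e
    regroup = solve-∀

  X : Series
  X zero    = + 0
  X (suc m) = const (+ 1) m

  X-⊛-suc : ∀ g m → (X ⊛ g) (suc m) ≡ g m
  X-⊛-suc g m = trans (ℤ.+-identityˡ _) (trans (const-⊛ (+ 1) g m) (ℤ.*-identityˡ (g m)))

  -- Power series modulo q^(n+1)

  module Truncated (n : ℕ) where

    infix 4 _≈_

    record _≈_ (f g : Series) : Set where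
      constructor mk
      field at : ∀ m → m ≤ n → f m ≡ g m
    open _≈_ public

    ≗⇒≈ : ∀ {f g} → f ≗ g → f ≈ g
    ≗⇒≈ f≗g = mk λ m _ → f≗g m

    ring : CommutativeRing 0ℓ 0ℓ
    ring = record
      { Carrier = Series
      ; _≈_ = _≈_
      ; _+_ = _⊕_
      ; _*_ = _⊛_
      ; -_  = λ f m → ℤ.- f m
      ; 0#  = λ _ → + 0
      ; 1#  = const (+ 1)
      ; isCommutativeRing = record
        { isRing = record
          { +-isAbelianGroup = record
            { isGroup = record
              { isMonoid = record
                { isSemigroup = record
                  { isMagma = record
                    { isEquivalence = record
                      { refl  = mk λ _ _ → refl
                      ; sym   = λ p → mk λ m m≤n → sym (at p m m≤n)
                      ; trans = λ p r → mk λ m m≤n → trans (at p m m≤n) (at r m m≤n)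
                      }
                    ; ∙-cong = λ p r → mk λ m m≤n → cong₂ ℤ._+_ (at p m m≤n) (at r m m≤n)
                    }
                  ; assoc = λ f g h → ≗⇒≈ λ m → ℤ.+-assoc (f m) (g m) (h m)
                  }
                ; identity = (λ f → ≗⇒≈ λ m → ℤ.+-identityˡ (f m)) , (λ f → ≗⇒≈ λ m → ℤ.+-identityʳ (f m))
                }
              ; inverse = (λ f → ≗⇒≈ λ m → ℤ.+-inverseˡ (f m)) , (λ f → ≗⇒≈ λ m → ℤ.+-inverseʳ (f m))
              ; ⁻¹-cong = λ p → mk λ m m≤n → cong ℤ.-_ (at p m m≤n)
              }
            ; comm = λ f g → ≗⇒≈ λ m → ℤ.+-comm (f m) (g m)
            }
          ; *-cong = λ p r → mk λ m m≤n → ⊛-cong-≤ m (λ j j≤m → at p j (ℕ.≤-trans j≤m m≤n))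
                                                     (λ j j≤m → at r j (ℕ.≤-trans j≤m m≤n))
          ; *-assoc = λ f g h → ≗⇒≈ (⊛-assoc f g h)
          ; *-identity = (λ f → ≗⇒≈ (identityˡ f)) , (λ f → ≗⇒≈ λ m → trans (⊛-comm f _ m) (identityˡ f m))
          ; distrib = (λ h f g → ≗⇒≈ (⊛-distribˡ h f g)) , (λ h f g → ≗⇒≈ (⊛-distribʳ h f g))
          }
        ; *-comm = λ f g → ≗⇒≈ (⊛-comm f g)
        }
      }
      where
      identityˡ : ∀ f → const (+ 1) ⊛ f ≗ f
      identityˡ f m = trans (const-⊛ (+ 1) f m) (ℤ.*-identityˡ (f m))

    const-homo : ℤ.+-*-rawRing -Raw-AlmostCommutative⟶ fromCommutativeRing ring
    const-homo = record
      { ⟦_⟧    = const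
      ; +-homo = λ a b → ≗⇒≈ λ { zero → refl ; (suc _) → refl }
      ; *-homo = λ a b → ≗⇒≈ λ { zero → refl ; (suc m) → sym (trans (const-⊛ a (const b) (suc m)) (ℤ.*-zeroʳ a)) }
      ; -‿homo = λ a → ≗⇒≈ λ { zero → refl ; (suc _) → refl }
      ; 0-homo = ≗⇒≈ λ { zero → refl ; (suc _) → refl }
      ; 1-homo = ≗⇒≈ λ _ → refl
      }

    open import Algebra.Properties.Semiring.Exp (CommutativeRing.semiring ring) public using (_^_)

    X^-coeff : ∀ s m → (X ^ s) m ≡ (if s ≡ᵇ m then + 1 else + 0)
    X^-coeff zero    zero    = refl
    X^-coeff zero    (suc m) = refl
    X^-coeff (suc s) zero    = refl
    X^-coeff (suc s) (suc m) = trans (X-⊛-suc (X ^ s) m) (X^-coeff s m)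

    const-X^-coeff : ∀ c s m → (const c ⊛ X ^ s) m ≡ (if s ≡ᵇ m then c else + 0)
    const-X^-coeff c s m = trans (const-⊛ c (X ^ s) m) (trans (cong (ℤ._*_ (c)) (X^-coeff s m)) (scale (s ≡ᵇ m)))
      where
      scale : ∀ b → c ℤ.* (if b then + 1 else + 0) ≡ (if b then c else + 0)
      scale true  = ℤ.*-identityʳ c
      scale false = ℤ.*-zeroʳ c

    X-nilpotent : X ^ suc n ≈ (λ _ → + 0)
    X-nilpotent = mk λ m m≤n → trans (X^-coeff (suc n) m) (vanish n m m≤n)
      where
      vanish : ∀ n m → m ≤ n → (if suc n ≡ᵇ m then + 1 else + 0) ≡ + 0
      vanish n       zero    _         = refl
      vanish (suc n) (suc m) (s≤s m≤n) = vanish n m m≤n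

-- Signs

sgn-+ : ∀ a b → sgn (a ℕ.+ b) ≡ sgn a ℤ.* sgn b
sgn-+ zero    b = sym (ℤ.*-identityˡ (sgn b))
sgn-+ (suc a) b = trans (cong ℤ.-_ (sgn-+ a b)) (ℤ.neg-distribˡ-* (sgn a) (sgn b))

sgn-*-suc : ∀ i m → sgn (i ℕ.* suc m) ≡ sgn i ℤ.* sgn (i ℕ.* m)
sgn-*-suc i m = trans (cong sgn (ℕ.*-suc i m)) (sgn-+ i (i ℕ.* m))

-- Splitting on the two values turns the halved sums of signs below into closed terms, so the
-- divisions by 2 evaluate.
sgn-±1 : ∀ m → sgn m ≡ + 1 ⊎ sgn m ≡ -[1+ 0 ]
sgn-±1 zero    = inj₁ refl
sgn-±1 (suc m) with sgn m | sgn-±1 m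
... | _ | inj₁ refl = inj₂ refl
... | _ | inj₂ refl = inj₁ refl

-- The weights on distinct partitions

distinctOnly : (Freq → ℤ) → Freq → ℤ
distinctOnly g f = if isDistinct f then g f else + 0

w-distinct : ∀ i f → isDistinct f ≡ true →
             w i f ≡ (+ 1 ℤ.- (+ 1 ℤ.- sgn (tStat f)) / + 2) ℤ.* sgn (i ℕ.* numParts f)
w-distinct i []               _ = refl
w-distinct i (zero ∷ f)       _ = refl
w-distinct i (suc zero ∷ f)   _ =
  cong (λ a → (+ 1 ℤ.- a) ℤ.* sgn (i ℕ.* numParts (1 ∷ f))) (ℤ.*-identityˡ ((+ 1 ℤ.- sgn (tStat (1 ∷ f))) / + 2))

w-recurrence : ∀ i → ChainRecurrence (sgn i) (+ 0)
                       (distinctOnly (λ f → sgn (i ℕ.* numParts f))) (distinctOnly (w i))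
w-recurrence i = record
  { δ-[] = cong sgn (ℕ.*-zeroʳ i)
  ; δ-0  = λ _ → refl
  ; δ-1  = δ-1
  ; δ-2  = λ _ _ → refl
  ; φ-[] = cong (λ m → + 1 ℤ.* sgn m) (ℕ.*-zeroʳ i)
  ; φ-0  = φ-0
  ; φ-1  = φ-1
  ; φ-2  = λ _ _ → refl
  }
  where
  δ : Freq → ℤ
  δ = distinctOnly (λ f → sgn (i ℕ.* numParts f))

  δ-1 : ∀ f → δ (1 ∷ f) ≡ sgn i ℤ.* δ f
  δ-1 f with isDistinct f
  ... | true  = sgn-*-suc i (numParts f)
  ... | false = sym (ℤ.*-zeroʳ (sgn i))

  φ-0 : ∀ f → distinctOnly (w i) (0 ∷ f) ≡ δ f
  φ-0 f with isDistinct f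
  ... | true  = ℤ.*-identityˡ _
  ... | false = refl

  -- Prepending a part lengthens the chain by one, so the indicator e of even t becomes 1 - e.
  complement : ∀ t → + 1 ℤ.- (+ 1 ℤ.- sgn (suc t)) / + 2 ≡ + 1 ℤ.- (+ 1 ℤ.- (+ 1 ℤ.- sgn t) / + 2)
  complement t with sgn t | sgn-±1 t
  ... | _ | inj₁ refl = refl
  ... | _ | inj₂ refl = refl

  regroup : ∀ e z s → (+ 1 ℤ.- e) ℤ.* (z ℤ.* s) ≡ z ℤ.* (s ℤ.- e ℤ.* s)
  regroup = solve-∀

  φ-1 : ∀ f → distinctOnly (w i) (1 ∷ f) ≡ sgn i ℤ.* (δ f ℤ.- distinctOnly (w i) f)
  φ-1 f with isDistinct f in eq
  ... | false = sym (ℤ.*-zeroʳ (sgn i))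
  ... | true  = begin
    w i (1 ∷ f)
      ≡⟨ w-distinct i (1 ∷ f) eq ⟩
    (+ 1 ℤ.- (+ 1 ℤ.- sgn (suc (tStat f))) / + 2) ℤ.* sgn (i ℕ.* suc (numParts f))
      ≡⟨ cong₂ ℤ._*_ (complement (tStat f)) (sgn-*-suc i (numParts f)) ⟩
    (+ 1 ℤ.- e) ℤ.* (sgn i ℤ.* s)
      ≡⟨ regroup e (sgn i) s ⟩
    sgn i ℤ.* (s ℤ.- e ℤ.* s)
      ≡⟨ cong (λ a → sgn i ℤ.* (s ℤ.- a)) (w-distinct i f eq) ⟨
    sgn i ℤ.* (s ℤ.- w i f) ∎
    where
    open ≡.≡-Reasoning
    e = + 1 ℤ.- (+ 1 ℤ.- sgn (tStat f)) / + 2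
    s = sgn (i ℕ.* numParts f)

-- Repeated parts and the statistics p₂ and r₂

-- The position of the last repeated part after prepending an entry; 0 means "none" and is kept.
shiftPos : ℕ → ℕ
shiftPos zero    = zero
shiftPos (suc p) = suc (suc p)

shiftPos-⊔ : ∀ a b → shiftPos (a ⊔ b) ≡ shiftPos a ⊔ shiftPos b
shiftPos-⊔ zero    b       = refl
shiftPos-⊔ (suc a) zero    = refl
shiftPos-⊔ (suc a) (suc b) = refl

pStat-∷ : ∀ j x f → pStat j (x ∷ f) ≡ (if j ≤ᵇ x then 1 else 0) ⊔ shiftPos (pStat j f)
pStat-∷ j x f = cong ((if j ≤ᵇ x then 1 else 0) ⊔_) (shift suc (suc ∘ suc) (λ _ → refl) (λ i → i , refl) f)
  where
  entry : ℕ → ℕ → ℕ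
  entry k y = if j ≤ᵇ y then k else 0

  -- The index functions are general because recursion composes both with `suc`. Positivity of `g`
  -- separates true positions from the default 0, which `shiftPos` keeps.
  shift : (g h : ℕ → ℕ) → (∀ i → h i ≡ suc (g i)) → (∀ i → ∃ λ a → g i ≡ suc a) → ∀ f →
          foldr _⊔_ 0 (zipWith entry (applyUpTo h (length f)) f) ≡
          shiftPos (foldr _⊔_ 0 (zipWith entry (applyUpTo g (length f)) f))
  shift g h h≡ g>0 []      = refl
  shift g h h≡ g>0 (y ∷ f) = trans
    (cong₂ _⊔_ (head (j ≤ᵇ y)) (shift (g ∘ suc) (h ∘ suc) (h≡ ∘ suc) (g>0 ∘ suc) f))
    (sym (shiftPos-⊔ (entry (g 0) y) _))
    where
    head : ∀ b → (if b then h 0 else 0) ≡ shiftPos (if b then g 0 else 0)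
    head false = refl
    head true with g 0 | g>0 0 | h 0 | h≡ 0
    ... | _ | a , refl | _ | refl = refl

pStat-distinct : ∀ f → isDistinct f ≡ true → pStat 2 f ≡ 0
pStat-distinct []             _  = refl
pStat-distinct (zero ∷ f)     eq = trans (pStat-∷ 2 0 f) (cong shiftPos (pStat-distinct f eq))
pStat-distinct (suc zero ∷ f) eq = trans (pStat-∷ 2 1 f) (cong shiftPos (pStat-distinct f eq))

-- The new first part is itself repeated, so the value 0 also moves up, to 1.
pStat-repeated : ∀ x f → pStat 2 (suc (suc x) ∷ f) ≡ suc (pStat 2 f)
pStat-repeated x f = trans (pStat-∷ 2 (suc (suc x)) f) (1⊔shiftPos (pStat 2 f))
  where
  1⊔shiftPos : ∀ p → 1 ⊔ shiftPos p ≡ suc p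
  1⊔shiftPos zero    = refl
  1⊔shiftPos (suc p) = refl

pStat-nondistinct : ∀ f → isDistinct f ≡ false → ∃ λ p → pStat 2 f ≡ suc p
pStat-nondistinct (suc (suc x) ∷ f) _  = pStat 2 f , pStat-repeated x f
pStat-nondistinct (zero ∷ f)        eq with p , p≡ ← pStat-nondistinct f eq =
  suc p , trans (pStat-∷ 2 0 f) (cong shiftPos p≡)
pStat-nondistinct (suc zero ∷ f)    eq with p , p≡ ← pStat-nondistinct f eq =
  suc p , trans (pStat-∷ 2 1 f) (cong shiftPos p≡)

rStat-distinct : ∀ f → isDistinct f ≡ true → rStat 2 f ≡ 0
rStat-distinct []             _  = refl
rStat-distinct (zero ∷ f)     eq = rStat-distinct f eq
rStat-distinct (suc zero ∷ f) eq = rStat-distinct f eq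

-- The weights on partitions with p₂ ≤ t

module _ (j : ℕ) where

  -- ŵ (suc j) restricted to 𝒜, as a function of t, p₂, r₁, r₂; the exponent loses t + p₂ because the
  -- middle factor vanishes unless t + p₂ is even.
  chainWeight : ℕ → ℕ → ℕ → ℕ → ℤ
  chainWeight t p r₁ r₂ =
    if p ≤ᵇ t then + (2 ℕ.^ r₂) ℤ.* ((sgn t ℤ.+ sgn p) / + 2) ℤ.* sgn (j ℕ.* r₁) else + 0

  mean-suc : ∀ t p → (sgn (suc t) ℤ.+ sgn (suc p)) / + 2 ≡ ℤ.- ((sgn t ℤ.+ sgn p) / + 2)
  mean-suc t p with sgn t | sgn-±1 t | sgn p | sgn-±1 p
  ... | _ | inj₁ refl | _ | inj₁ refl = refl
  ... | _ | inj₁ refl | _ | inj₂ refl = refl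
  ... | _ | inj₂ refl | _ | inj₁ refl = refl
  ... | _ | inj₂ refl | _ | inj₂ refl = refl

  mean-suc-0 : ∀ t → (sgn (suc t) ℤ.+ + 1) / + 2 ≡ + 1 ℤ.- (sgn t ℤ.+ + 1) / + 2
  mean-suc-0 t with sgn t | sgn-±1 t
  ... | _ | inj₁ refl = refl
  ... | _ | inj₂ refl = refl

  sgn-j*even : ∀ m → sgn m ≡ + 1 → ∀ k → sgn (k ℕ.* m) ≡ + 1
  sgn-j*even m even zero    = refl
  sgn-j*even m even (suc k) = trans (sgn-+ m (k ℕ.* m)) (cong₂ ℤ._*_ even (sgn-j*even m even k))

  mean-parity : ∀ t p → (sgn t ℤ.+ sgn p) / + 2 ℤ.* sgn (j ℕ.* (t ℕ.+ p)) ≡ (sgn t ℤ.+ sgn p) / + 2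
  mean-parity t p with sgn t in eqt | sgn-±1 t | sgn p in eqp | sgn-±1 p
  ... | _ | inj₁ refl | _ | inj₂ refl = refl
  ... | _ | inj₂ refl | _ | inj₁ refl = refl
  ... | _ | inj₁ refl | _ | inj₁ refl = cong (ℤ._*_ (+ 1))
    (sgn-j*even (t ℕ.+ p) (trans (sgn-+ t p) (cong₂ ℤ._*_ eqt eqp)) j)
  ... | _ | inj₂ refl | _ | inj₂ refl = cong (ℤ._*_ (-[1+ 0 ]))
    (sgn-j*even (t ℕ.+ p) (trans (sgn-+ t p) (cong₂ ℤ._*_ eqt eqp)) j)

  ŵ-on-A : Freq → ℤ
  ŵ-on-A f = if inA f then ŵ (suc j) f else + 0

  ŵ-chainWeight : ∀ f {p₂ r₂} → pStat 2 f ≡ p₂ → rStat 2 f ≡ r₂ →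
                  ŵ-on-A f ≡ chainWeight (tStat f) p₂ (rStat 1 f) r₂
  ŵ-chainWeight f refl refl = cong (λ a → if inA f then a else + 0) (begin
    P ℤ.* M ℤ.* sgn (j ℕ.* (r ℕ.+ t ℕ.+ p))
      ≡⟨ cong (ℤ._*_ (P ℤ.* M)) (trans (cong sgn (trans (cong (j ℕ.*_) (ℕ.+-assoc r t p)) (ℕ.*-distribˡ-+ j r (t ℕ.+ p))))
                                    (sgn-+ (j ℕ.* r) (j ℕ.* (t ℕ.+ p)))) ⟩
    P ℤ.* M ℤ.* (sgn (j ℕ.* r) ℤ.* sgn (j ℕ.* (t ℕ.+ p)))
      ≡⟨ regroup P M _ _ ⟩
    P ℤ.* (M ℤ.* sgn (j ℕ.* (t ℕ.+ p))) ℤ.* sgn (j ℕ.* r)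
      ≡⟨ cong (λ a → P ℤ.* a ℤ.* sgn (j ℕ.* r)) (mean-parity t p) ⟩
    P ℤ.* M ℤ.* sgn (j ℕ.* r) ∎)
    where
    open ≡.≡-Reasoning
    t = tStat f
    p = pStat 2 f
    r = rStat 1 f
    P = + (2 ℕ.^ rStat 2 f)
    M = (sgn t ℤ.+ sgn p) / + 2
    regroup : ∀ a b c d → a ℤ.* b ℤ.* (c ℤ.* d) ≡ a ℤ.* (b ℤ.* d) ℤ.* c
    regroup = solve-∀

  ≤ᵇ-suc : ∀ p t → (suc p ≤ᵇ suc t) ≡ (p ≤ᵇ t)
  ≤ᵇ-suc zero    t = refl
  ≤ᵇ-suc (suc p) t = refl

  private
    ζ = sgn j

  -- A single new part before a partition with repetitions raises t and p₂ together: the condition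
  -- p₂ ≤ t persists and the mean of signs is negated. The `+ 0` is the value of δ on such a
  -- partition.
  chainWeight-single : ∀ t p r₁ r₂ → chainWeight (suc t) (suc p) (suc r₁) r₂ ≡ ζ ℤ.* (+ 0 ℤ.- chainWeight t p r₁ r₂)
  chainWeight-single t p r₁ r₂ rewrite ≤ᵇ-suc p t with p ≤ᵇ t
  ... | false = sym (ℤ.*-zeroʳ ζ)
  ... | true  = trans (cong₂ (λ a b → + (2 ℕ.^ r₂) ℤ.* a ℤ.* b) (mean-suc t p) (sgn-*-suc j r₁))
                      (regroup (+ (2 ℕ.^ r₂)) _ ζ _)
    where
    regroup : ∀ a b c d → a ℤ.* (ℤ.- b) ℤ.* (c ℤ.* d) ≡ c ℤ.* (+ 0 ℤ.- a ℤ.* b ℤ.* d)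
    regroup = solve-∀

  -- As for a single part, with one more factor 2 from r₂.
  chainWeight-repeated : ∀ t p r₁ r₂ →
    chainWeight (suc t) (suc p) (suc r₁) (suc r₂) ≡ ℤ.- (+ 2 ℤ.* ζ) ℤ.* chainWeight t p r₁ r₂
  chainWeight-repeated t p r₁ r₂ rewrite ≤ᵇ-suc p t with p ≤ᵇ t
  ... | false = sym (ℤ.*-zeroʳ (ℤ.- (+ 2 ℤ.* ζ)))
  ... | true  = trans
    (cong₂ ℤ._*_ (cong₂ ℤ._*_ (ℤ.pos-* 2 (2 ℕ.^ r₂)) (mean-suc t p)) (sgn-*-suc j r₁))
    (regroup (+ 2) (+ (2 ℕ.^ r₂)) _ ζ _)
    where
    regroup : ∀ k a b c d → k ℤ.* a ℤ.* (ℤ.- b) ℤ.* (c ℤ.* d) ≡ ℤ.- (k ℤ.* c) ℤ.* (a ℤ.* b ℤ.* d)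
    regroup = solve-∀

  -- Without repetitions p₂ stays 0 while t grows, so the mean of signs passes to its complement
  -- instead of being negated.
  chainWeight-distinct : ∀ t r₁ → chainWeight (suc t) 0 (suc r₁) 0 ≡ ζ ℤ.* (sgn (j ℕ.* r₁) ℤ.- chainWeight t 0 r₁ 0)
  chainWeight-distinct t r₁ = trans
    (cong₂ (λ a b → + 1 ℤ.* a ℤ.* b) (mean-suc-0 t) (sgn-*-suc j r₁))
    (regroup ((sgn t ℤ.+ + 1) / + 2) ζ (sgn (j ℕ.* r₁)))
    where
    regroup : ∀ b c d → + 1 ℤ.* (+ 1 ℤ.- b) ℤ.* (c ℤ.* d) ≡ c ℤ.* (d ℤ.- + 1 ℤ.* b ℤ.* d)
    regroup = solve-∀

  ŵ-recurrence : ChainRecurrence ζ (ℤ.- (+ 2 ℤ.* ζ)) (distinctOnly (λ f → sgn (j ℕ.* rStat 1 f))) ŵ-on-A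
  ŵ-recurrence = record
    { δ-[] = cong sgn (ℕ.*-zeroʳ j)
    ; δ-0  = λ _ → refl
    ; δ-1  = δ-1
    ; δ-2  = λ _ _ → refl
    ; φ-[] = trans (ŵ-chainWeight [] refl refl) (cong (λ m → + 1 ℤ.* sgn m) (ℕ.*-zeroʳ j))
    ; φ-0  = φ-0
    ; φ-1  = φ-1
    ; φ-2  = φ-2
    }
    where
    open ≡.≡-Reasoning
    δ : Freq → ℤ
    δ = distinctOnly (λ f → sgn (j ℕ.* rStat 1 f))

    δ-1 : ∀ f → δ (1 ∷ f) ≡ ζ ℤ.* δ f
    δ-1 f with isDistinct f
    ... | true  = sgn-*-suc j (rStat 1 f)
    ... | false = sym (ℤ.*-zeroʳ ζ)

    φ-0 : ∀ f → ŵ-on-A (0 ∷ f) ≡ δ f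
    φ-0 f with isDistinct f in eq
    ... | true  = trans (ŵ-chainWeight (0 ∷ f) (pStat-distinct (0 ∷ f) eq) (rStat-distinct f eq)) (ℤ.*-identityˡ _)
    -- Here t = 0 < p₂, so the partition violates p₂ ≤ t and has weight 0.
    ... | false with p , p≡ ← pStat-nondistinct f eq =
      ŵ-chainWeight (0 ∷ f) (trans (pStat-∷ 2 0 f) (cong shiftPos p≡)) refl

    φ-1 : ∀ f → ŵ-on-A (1 ∷ f) ≡ ζ ℤ.* (δ f ℤ.- ŵ-on-A f)
    φ-1 f with isDistinct f in eq
    ... | true  = begin
      ŵ-on-A (1 ∷ f)
        ≡⟨ ŵ-chainWeight (1 ∷ f) (pStat-distinct (1 ∷ f) eq) (rStat-distinct f eq) ⟩
      chainWeight (suc (tStat f)) 0 (suc (rStat 1 f)) 0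
        ≡⟨ chainWeight-distinct (tStat f) (rStat 1 f) ⟩
      ζ ℤ.* (sgn (j ℕ.* rStat 1 f) ℤ.- chainWeight (tStat f) 0 (rStat 1 f) 0)
        ≡⟨ cong (λ a → ζ ℤ.* (sgn (j ℕ.* rStat 1 f) ℤ.- a))
                (ŵ-chainWeight f (pStat-distinct f eq) (rStat-distinct f eq)) ⟨
      ζ ℤ.* (sgn (j ℕ.* rStat 1 f) ℤ.- ŵ-on-A f) ∎
    ... | false with p , p≡ ← pStat-nondistinct f eq = begin
      ŵ-on-A (1 ∷ f)
        ≡⟨ ŵ-chainWeight (1 ∷ f) (trans (pStat-∷ 2 1 f) (cong shiftPos p≡)) refl ⟩
      chainWeight (suc (tStat f)) (suc (suc p)) (suc (rStat 1 f)) (rStat 2 f)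
        ≡⟨ chainWeight-single (tStat f) (suc p) (rStat 1 f) (rStat 2 f) ⟩
      ζ ℤ.* (+ 0 ℤ.- chainWeight (tStat f) (suc p) (rStat 1 f) (rStat 2 f))
        ≡⟨ cong (λ a → ζ ℤ.* (+ 0 ℤ.- a)) (ŵ-chainWeight f p≡ refl) ⟨
      ζ ℤ.* (+ 0 ℤ.- ŵ-on-A f) ∎

    φ-2 : ∀ x f → ŵ-on-A (suc (suc x) ∷ f) ≡ ℤ.- (+ 2 ℤ.* ζ) ℤ.* ŵ-on-A f
    φ-2 x f = begin
      ŵ-on-A (suc (suc x) ∷ f)
        ≡⟨ ŵ-chainWeight (suc (suc x) ∷ f) (pStat-repeated x f) refl ⟩
      chainWeight (suc (tStat f)) (suc (pStat 2 f)) (suc (rStat 1 f)) (suc (rStat 2 f))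
        ≡⟨ chainWeight-repeated (tStat f) (pStat 2 f) (rStat 1 f) (rStat 2 f) ⟩
      ℤ.- (+ 2 ℤ.* ζ) ℤ.* chainWeight (tStat f) (pStat 2 f) (rStat 1 f) (rStat 2 f)
        ≡⟨ cong (ℤ._*_ (ℤ.- (+ 2 ℤ.* ζ))) (ŵ-chainWeight f refl refl) ⟨
      ℤ.- (+ 2 ℤ.* ζ) ℤ.* ŵ-on-A f ∎

-- Extraction of coefficients

sumℤ-filterᵇ : {A : Set} (P : A → Bool) (g : A → ℤ) (as : List A) →
               sumℤ (map g (filterᵇ P as)) ≡ sumℤ (map (λ a → if P a then g a else + 0) as)
sumℤ-filterᵇ P g []       = refl
sumℤ-filterᵇ P g (a ∷ as) with P a
... | true  = cong (ℤ._+_ (g a)) (sumℤ-filterᵇ P g as)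
... | false = trans (sumℤ-filterᵇ P g as) (sym (ℤ.+-identityˡ _))

size≡sizeFrom : ∀ f → size f ≡ sizeFrom 0 f
size≡sizeFrom = go 0 suc (λ _ → refl)
  where
  go : ∀ k (h : ℕ → ℕ) → (∀ i → h i ≡ suc k ℕ.+ i) → ∀ f →
       sum (zipWith ℕ._*_ (applyUpTo h (length f)) f) ≡ sizeFrom k f
  go k h h≡ []      = refl
  go k h h≡ (x ∷ f) = cong₂ ℕ._+_
    (cong (ℕ._* x) (trans (h≡ 0) (ℕ.+-identityʳ (suc k))))
    (go (suc k) (h ∘ suc) (λ i → trans (h≡ (suc i)) (cong suc (ℕ.+-suc k i))) f)

module _ (N : ℕ) where
  private
    n = suc N
  open PowerSeries
  open Truncated n
  open GeneratingFunctions ring const-homo N X X-nilpotent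

  -- `GF` runs over lists of every size; reading off degree n performs the selection made by the
  -- filter in `partitionsOf`.
  coeff-GF : ∀ P g → GF (λ f → if P f then g f else + 0) n 0 n ≡ sumℤ (map g (filterᵇ P (partitionsOf n)))
  coeff-GF P g = trans (coeff (allLists n n))
    (sym (trans (sumℤ-filterᵇ P g (partitionsOf n)) (sumℤ-filterᵇ (λ f → size f ≡ᵇ n) φ (allLists n n))))
    where
    φ : Freq → ℤ
    φ f = if P f then g f else + 0
    coeff : ∀ fs → ∑∈ fs (λ f → const (φ f) ⊛ X ^ sizeFrom 0 f) n ≡
                   sumℤ (map (λ f → if size f ≡ᵇ n then φ f else + 0) fs)
    coeff []       = refl
    coeff (f ∷ fs) = cong₂ ℤ._+_
      (trans (const-X^-coeff (φ f) (sizeFrom 0 f) n)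
             (cong (λ s → if s ≡ᵇ n then φ f else + 0) (sym (size≡sizeFrom f))))
      (coeff fs)

  coefficients-agree : ∀ j → lhsCoeff (suc j) n ≡ rhsCoeff (suc j) n
  coefficients-agree j = begin
    lhsCoeff (suc j) n                      ≡⟨ coeff-GF isDistinct (w (suc j)) ⟨
    -- The recurrences fit together because `sgn (suc j)` is by definition the negative of `sgn j`,
    -- the ζ of the right side.
    GF (distinctOnly (w (suc j))) n 0 n     ≡⟨ at (GF-equal (w-recurrence (suc j)) (ŵ-recurrence j)) n ℕ.≤-refl ⟩
    GF (ŵ-on-A j) n 0 n                     ≡⟨ coeff-GF inA (ŵ (suc j)) ⟩
    rhsCoeff (suc j) n                      ∎
    where open ≡.≡-Reasoning

theorem3p1 : (i : ℕ) → i ≡ 1 ⊎ i ≡ 2 → (n : ℕ) → lhsCoeff i n ≡ rhsCoeff i n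
-- The general argument separates multiplicities 0 and 1 in a range up to n, which requires n ≥ 1;
-- the constant terms are evaluated directly.
theorem3p1 _ (inj₁ refl) zero    = refl
theorem3p1 _ (inj₂ refl) zero    = refl
theorem3p1 _ (inj₁ refl) (suc N) = coefficients-agree N 0
theorem3p1 _ (inj₂ refl) (suc N) = coefficients-agree N 1
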